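{- Let $p\ge5$. For every assignment $\alpha$ on the white metallic tree, $\mathcal W_\alpha$ possesses the preferred son property: for every node $\nu$, exactly one son of $\nu$ in $\mathcal W_\alpha$ has metallic code ending with $0$, and the metallic code of that son is the metallic code of $\nu$ followed by $0$ (this son is called the preferred son of $\nu$). Moreover, for every $n\ge0$, $m_{n+1}$ is the preferred son of $m_n$ in $\mathcal W_\alpha$.
   Context: Fix $p\ge5$. Metallic numbers: $m_{ -1}=0$, $m_0=1$, $m_{n+2}=(p-2)m_{n+1}-m_n$. With $d=p-3$, $c=p-4$, the metallic code of a positive integer $n$ is the unique word $a_k\cdots a_0$ over $\{0,\dots,p-3\}$ with $a_k\ne0$, $n=\sum a_im_i$, containing no factor $d\,c^j\,d$ ($j\ge0$). White metallic tree under an assignment $\alpha$, $\mathcal W_\alpha$: nodes are the positive integers, each black or white; root $1$ is white; nodes are processed in increasing order and node $\nu$ receives $p-2$ sons if white and $p-3$ sons if black, namely the smallest integers not yet used, in increasing order; an assignment specifies, for each node, the position (leftmost = $1$) of its unique black son among its sons (possibly depending on the node), other sons being white. -}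

module Defs where

open import Data.Bool.Base using (if_then_else_)
open import Data.Empty using (⊥)
open import Data.List.Base using (List; []; _∷_; _∷ʳ_; length; replicate)
open import Data.List.Relation.Binary.Infix.Heterogeneous using (Infix)
open import Data.List.Relation.Unary.All using (All)
open import Data.Nat.Base using (ℕ; zero; suc; pred; _+_; _*_; _∸_; _≤_; _<_)
open import Data.Nat.Properties using (_≟_; _<?_)
open import Data.Product using (_×_; ∃; ∃!)
open import Relation.Binary.PropositionalEquality using (_≡_; _≢_)
open import Relation.Nullary using (¬_; does)

-- Indices are shifted by one: m₋₁ p k is m_{k-1}.  For p ≥ 4 the sequence is
-- increasing, so the truncated subtraction is the exact one.
m₋₁ : ℕ → ℕ → ℕ
m₋₁ p zero          = 0
m₋₁ p (suc zero)    = 1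
m₋₁ p (suc (suc k)) = (p ∸ 2) * m₋₁ p (suc k) ∸ m₋₁ p k

m : ℕ → ℕ → ℕ
m p n = m₋₁ p (suc n)

-- Words are written with the most significant digit a_k first.
value : ℕ → List ℕ → ℕ
value p []      = 0
value p (a ∷ w) = a * m p (length w) + value p w

LeadingNonZero : List ℕ → Set
LeadingNonZero []      = ⊥
LeadingNonZero (a ∷ w) = a ≢ 0

forbidden : ℕ → ℕ → List ℕ
forbidden p j = d ∷ replicate j c ∷ʳ d
  where
  d = p ∸ 3
  c = p ∸ 4

record IsMetallicWord (p n : ℕ) (w : List ℕ) : Set where
  field
    digits          : All (_≤ p ∸ 3) w
    leading-nonzero : LeadingNonZero w
    represents      : n ≡ value p w
    no-forbidden    : ∀ j → ¬ Infix _≡_ (forbidden p j) w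

-- w is "the unique word such that …": uniqueness is part of being the code.
MetallicCode : ℕ → ℕ → List ℕ → Set
MetallicCode p n w =
  IsMetallicWord p n w × (∀ {v} → IsMetallicWord p n v → w ≡ v)

CodeEndsWith0 : ℕ → ℕ → Set
CodeEndsWith0 p n = ∃ λ w → MetallicCode p n (w ∷ʳ 0)

data Colour : Set where
  black white : Colour

sonCount : ℕ → Colour → ℕ
sonCount p white = p ∸ 2
sonCount p black = p ∸ 3

-- The used integers are 1, …, firstUnused ∸ 1.  Only they have a meaningful
-- colour: the colour of any other number is a placeholder that is overwritten
-- when the number is used.
record State : Set where
  constructor mkState
  field
    firstUnused : ℕ
    colourOf    : ℕ → Colour

open State

initial : State
initial = mkState 2 (λ _ → white)

-- Gives node ν its sons, the k-th of them (counted from 1) being black.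
process : ℕ → (ν k : ℕ) → State → State
process p ν k (mkState next col) = mkState
  (next + sonCount p (col ν))
  (λ s → if does (s <? next) then col s
         else if does (suc s ≟ next + k) then black
         else white)

-- The state once the nodes 1, …, t have been processed, where α ν is the
-- position of the black son of ν.
after : ℕ → (ℕ → ℕ) → ℕ → State
after p α zero    = initial
after p α (suc t) = process p (suc t) (α (suc t)) (after p α t)

-- Node ν is processed in this state (ν ≥ 1).
before : ℕ → (ℕ → ℕ) → ℕ → State
before p α ν = after p α (pred ν)

colour : ℕ → (ℕ → ℕ) → ℕ → Colour
colour p α ν = colourOf (before p α ν) ν

IsAssignment : ℕ → (ℕ → ℕ) → Set
IsAssignment p α = ∀ ν → 1 ≤ ν → 1 ≤ α ν × α ν ≤ sonCount p (colour p α ν)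

IsSon : ℕ → (ℕ → ℕ) → ℕ → ℕ → Set
IsSon p α ν s =
  firstUnused (before p α ν) ≤ s × s < firstUnused (after p α ν)

IsPreferredSon : ℕ → (ℕ → ℕ) → ℕ → ℕ → Set
IsPreferredSon p α ν s = IsSon p α ν s × CodeEndsWith0 p s

PreferredSonProperty : ℕ → (ℕ → ℕ) → Set
PreferredSonProperty p α = ∀ ν → 1 ≤ ν →
  ∃! _≡_ (IsPreferredSon p α ν)
  × (∀ s → IsPreferredSon p α ν s →
       ∃ λ w → MetallicCode p ν w × MetallicCode p s (w ∷ʳ 0))

{-# OPTIONS --safe #-}

-- Let F t be the first integer unused once 1, …, t are processed and B n the
-- number of black nodes below n.  Whatever the assignment, every node has one
-- black son, so B (F t) = t and F t + B (t + 1) = (p − 2) t + 2.  On the other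
-- hand x = value (w a) and y = value w satisfy value (w a 0) + y = (p − 2) x, so
-- value (w a 0) is a son of x as soon as y ≤ B x + 1 and B (x + 1) ≤ y + 1.  By
-- induction value (w 0) is a son of y, whence F (y − 1) ≤ x < F (y + 1) for
-- x = value (w 0) + a, and applying B gives both bounds.  Metallic words are those
-- accepted by a two-state automaton, whose words of length j represent each of
-- 0, …, m_j − 1 exactly once.
module Submission where

open import Defs
open State
open import Data.Bool.Base using (if_then_else_)
open import Data.Empty using (⊥-elim)
open import Data.List.Base using (List; []; _∷_; _∷ʳ_; length; replicate)
open import Data.List.Properties using (length-++; length-replicate)
open import Data.List.Relation.Binary.Infix.Heterogeneous using (Infix; here; there)
open import Data.List.Relation.Binary.Prefix.Heterogeneous using (Prefix; []; _∷_)
open import Data.List.Relation.Unary.All using (All; []; _∷_)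
open import Data.List.Relation.Unary.All.Properties using (∷ʳ⁻)
open import Data.List.Reverse using (Reverse; []; _∶_∶ʳ_; reverseView)
open import Data.Nat.Base
open import Data.Nat.DivMod
open import Data.Nat.Properties
open import Data.Nat.Tactic.RingSolver using (solve-∀)
open import Data.Product using (_×_; _,_; proj₁; proj₂; ∃)
open import Data.Sum.Base using (inj₁; inj₂)
open import Function.Base using (_∘_)
open import Relation.Binary.Definitions using (tri<; tri≈; tri>)
open import Relation.Binary.PropositionalEquality
open import Relation.Nullary using (Dec; ¬_; does; yes; no; contradiction)
open import Relation.Nullary.Decidable using (dec-true; dec-false)

length-∷ʳ : ∀ (w : List ℕ) a → length (w ∷ʳ a) ≡ suc (length w)
length-∷ʳ w a = trans (length-++ w) (+-comm (length w) 1)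

if-yes : ∀ {A X : Set} {x y : X} (A? : Dec A) → A → (if does A? then x else y) ≡ x
if-yes {x = x} {y} A? a = cong (λ b → if b then x else y) (dec-true A? a)

if-no : ∀ {A X : Set} {x y : X} (A? : Dec A) → ¬ A → (if does A? then x else y) ≡ y
if-no {x = x} {y} A? ¬a = cong (λ b → if b then x else y) (dec-false A? ¬a)

divide : ∀ {M e n} → 0 < M → n < e * M →
  ∃ λ a → ∃ λ r → a < e × r < M × a * M + r ≡ n
divide {M} {e} {n} 0<M n<eM =
  n / M , n % M , m<n*o⇒m/o<n n<eM , m%n<n n M ,
  trans (+-comm (n / M * M) _) (sym (m≡m%n+[m/n]*n n M))
  where instance M≢0 = >-nonZero 0<M

-- Metallic words and the two-state automaton.

module Numeration (k : ℕ) where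

  -- With `p` in the form `5 + k`, the truncated differences `p ∸ 2`, `p ∸ 3` and `p ∸ 4` compute to
  -- `3 + k`, `d` and `c`.
  p c d : ℕ
  p = 5 + k
  c = 1 + k
  d = 2 + k

  -- The two states of the automaton are named by the largest digit they allow:
  -- d initially, and c after a factor d cʲ.
  data Accepted : ℕ → List ℕ → Set where
    []    : ∀ {e} → Accepted e []
    below : ∀ {e a w} → a < e → Accepted d w → Accepted e (a ∷ w)
    top   : ∀ {e w} → Accepted c w → Accepted e (e ∷ w)

  relax : ∀ {w} → Accepted c w → Accepted d w
  relax []              = []
  relax (below a<c acc) = below (m<n⇒m<1+n a<c) acc
  relax (top acc)       = below ≤-refl (relax acc)

  accepted-tail : ∀ {e a w} → Accepted e (a ∷ w) → Accepted d w
  accepted-tail (below _ acc) = acc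
  accepted-tail (top acc)     = relax acc

  accepted-∷ʳ0 : ∀ {e w} → 0 < e → Accepted e w → Accepted e (w ∷ʳ 0)
  accepted-∷ʳ0 0<e []              = below 0<e []
  accepted-∷ʳ0 0<e (below a<e acc) = below a<e (accepted-∷ʳ0 z<s acc)
  accepted-∷ʳ0 0<e (top acc)       = top (accepted-∷ʳ0 z<s acc)

  accepted-init : ∀ {e a} w → Accepted e (w ∷ʳ a) → Accepted e w
  accepted-init []      _               = []
  accepted-init (b ∷ w) (below b<e acc) = below b<e (accepted-init w acc)
  accepted-init (b ∷ w) (top acc)       = top (accepted-init w acc)

  accepted⇒digits : ∀ {w} → Accepted d w → All (_≤ d) w
  accepted⇒digits []              = []
  accepted⇒digits (below a<d acc) = <⇒≤ a<d ∷ accepted⇒digits acc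
  accepted⇒digits (top acc)       = ≤-refl ∷ accepted⇒digits (relax acc)

  -- In state `c` some `d cⁱ` has just been read, so `cʲ d` would complete a forbidden factor.
  -- Reading `c` keeps the state, and `d` exceeds every digit it allows.
  accepted⇒no-prefix : ∀ {w} → Accepted c w → ∀ j → ¬ Prefix _≡_ (replicate j c ∷ʳ d) w
  accepted⇒no-prefix (below d<c _) zero    (refl ∷ _)   = <-asym d<c ≤-refl
  accepted⇒no-prefix (top _)       zero    (eq ∷ _)     = 1+n≢n eq
  accepted⇒no-prefix (below c<c _) (suc j) (refl ∷ _)   = <-irrefl refl c<c
  accepted⇒no-prefix (top acc)     (suc j) (_ ∷ prefix) = accepted⇒no-prefix acc j prefix

  accepted⇒no-forbidden : ∀ {w} → Accepted d w → ∀ j → ¬ Infix _≡_ (forbidden p j) w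
  accepted⇒no-forbidden (below d<d _) j (here (refl ∷ _))   = <-irrefl refl d<d
  accepted⇒no-forbidden (top acc)     j (here (_ ∷ prefix)) = accepted⇒no-prefix acc j prefix
  accepted⇒no-forbidden (below _ acc) j (there inf)         = accepted⇒no-forbidden acc j inf
  accepted⇒no-forbidden (top acc)     j (there inf)         = accepted⇒no-forbidden (relax acc) j inf
  accepted⇒no-forbidden []            j (here ())

  mutual
    accept : ∀ {w} → All (_≤ d) w → (∀ j → ¬ Infix _≡_ (forbidden p j) w) → Accepted d w
    accept []           _  = []
    accept (a≤d ∷ rest) ok with m≤n⇒m<n∨m≡n a≤d
    ... | inj₁ a<d  = below a<d (accept rest (λ j → ok j ∘ there))
    ... | inj₂ refl = top (accept-c rest (λ j → ok j ∘ there) (λ j → ok j ∘ here ∘ (refl ∷_)))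

    -- The last hypothesis remembers the `d cⁱ` just read: no `cʲ d` may complete it. Reading
    -- another `c` passes it on with `j` shifted by one.
    accept-c : ∀ {w} → All (_≤ d) w → (∀ j → ¬ Infix _≡_ (forbidden p j) w) →
      (∀ j → ¬ Prefix _≡_ (replicate j c ∷ʳ d) w) → Accepted c w
    accept-c []           _  _   = []
    accept-c {a ∷ _} (a≤d ∷ rest) ok okᵖ with <-cmp a c
    ... | tri< a<c _ _  = below a<c (accept rest (λ j → ok j ∘ there))
    ... | tri≈ _ refl _ =
      top (accept-c rest (λ j → ok j ∘ there) (λ j → okᵖ (suc j) ∘ (refl ∷_)))
    ... | tri> _ _ a>c  =
      contradiction (≤-antisym a>c a≤d ∷ []) (okᵖ 0)

  -- Counting accepted words by metallic numbers.

  -- The number of words of length `j` accepted from state `e`: each first digit below `e` leaves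
  -- `m p j` tails, the first digit `e` leaves `bound c j`.
  bound : ℕ → ℕ → ℕ
  bound e zero    = 1
  bound e (suc j) = e * m p j + bound c j

  -- Besides tying the counts to `m`, this shows the truncated subtraction in `m₋₁` to be exact: the
  -- subtracted term is split off from `m p j` and cancelled.
  m-gap : ∀ j → m p j ≡ m₋₁ p j + bound c j
  m-gap zero    = refl
  m-gap (suc j) = begin
    M + (M + (M + k * M)) ∸ N         ≡⟨ cong (λ x → x + (M + (M + k * M)) ∸ N) (m-gap j) ⟩
    N + g + (M + (M + k * M)) ∸ N     ≡⟨ cong (_∸ N) (rearrange N g M k) ⟩
    N + (M + (M + k * M + g)) ∸ N     ≡⟨ m+n∸m≡n N _ ⟩
    M + (M + k * M + g)               ∎
    where
    open ≡-Reasoning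
    M = m p j
    N = m₋₁ p j
    g = bound c j
    rearrange : ∀ N g M k → N + g + (M + (M + k * M)) ≡ N + (M + (M + k * M + g))
    rearrange = solve-∀

  -- As `d` is `1 + c`, this is `m-gap` regrouped.
  bound-d : ∀ j → bound d j ≡ m p j
  bound-d zero    = refl
  bound-d (suc j) = trans (+-assoc (m p j) _ _) (sym (m-gap (suc j)))

  m₋₁≤m : ∀ j → m₋₁ p j ≤ m p j
  m₋₁≤m j = subst (m₋₁ p j ≤_) (sym (m-gap j)) (m≤m+n _ _)

  m-recurrence : ∀ j → m p (suc j) + m₋₁ p j ≡ (3 + k) * m p j
  m-recurrence j = m∸n+n≡m (≤-trans (m₋₁≤m j) (m≤m+n _ _))

  bound-positive : ∀ e j → 1 ≤ bound e j
  bound-positive e zero    = ≤-refl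
  bound-positive e (suc j) = ≤-trans (bound-positive c j) (m≤n+m _ _)

  -- Each gap is at least 1. The bound guarantees that length `n` suffices for a word representing
  -- `n`.
  n<m : ∀ n → n < m p n
  n<m zero    = ≤-refl
  n<m (suc n) = begin
    2 + n                       ≡⟨ +-comm 1 (suc n) ⟩
    suc n + 1                   ≤⟨ +-mono-≤ (n<m n) (bound-positive c (suc n)) ⟩
    m p n + bound c (suc n)     ≡⟨ m-gap (suc n) ⟨
    m p (suc n)                 ∎
    where open ≤-Reasoning

  m-mono : ∀ {i j} → i ≤ j → m p i ≤ m p j
  m-mono = mono ∘ ≤⇒≤′
    where
    mono : ∀ {i j} → i ≤′ j → m p i ≤ m p j
    mono ≤′-refl       = ≤-refl
    mono (≤′-step {n} i≤n) = ≤-trans (mono i≤n) (m₋₁≤m (suc n))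

  mutual
    -- A first digit below `e` frees the tail, which then stays below the metallic number of its
    -- length; the digit `e` puts the tail in state `c`.
    value<bound : ∀ {e w} → Accepted e w → value p w < bound e (length w)
    value<bound []                              = ≤-refl
    value<bound {e} {a ∷ w} (below a<e acc)     = begin-strict
      a * m p (length w) + value p w         <⟨ +-monoʳ-< (a * m p (length w)) (value<m acc) ⟩
      a * m p (length w) + m p (length w)    ≡⟨ +-comm (a * m p (length w)) _ ⟩
      suc a * m p (length w)                 ≤⟨ *-monoˡ-≤ (m p (length w)) a<e ⟩
      e * m p (length w)                     ≤⟨ m≤m+n _ _ ⟩
      bound e (suc (length w))               ∎
      where open ≤-Reasoning
    value<bound {e} (top acc)                   = +-monoʳ-< (e * _) (value<bound acc)

    value<m : ∀ {w} → Accepted d w → value p w < m p (length w)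
    value<m {w} acc = subst (value p w <_) (bound-d (length w)) (value<bound acc)

  -- Uniqueness of the metallic code.

  leading-digit-≤ : ∀ {M a b x y} → x < M → a * M + x ≡ b * M + y → b ≤ a
  leading-digit-≤ {M} {a} {b} {x} {y} x<M eq = ≮⇒≥ λ a<b → <-irrefl eq (begin-strict
    a * M + x   <⟨ +-monoʳ-< (a * M) x<M ⟩
    a * M + M   ≡⟨ +-comm (a * M) M ⟩
    suc a * M   ≤⟨ *-monoˡ-≤ M a<b ⟩
    b * M       ≤⟨ m≤m+n _ _ ⟩
    b * M + y   ∎)
    where open ≤-Reasoning

  -- Both tails lie below the same metallic number, so the leading digits agree as in Euclidean
  -- division, and then cancel.
  value-injective : ∀ {v w} → Accepted d v → Accepted d w →
    length v ≡ length w → value p v ≡ value p w → v ≡ w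
  value-injective {[]}    {[]}    _ _ _ _ = refl
  value-injective {a ∷ v} {b ∷ w} accᵛ accʷ len eq = cong₂ _∷_ a≡b v≡w
    where
    lenᵗ : length v ≡ length w
    lenᵗ = suc-injective len
    accᵛ′ = accepted-tail accᵛ
    accʷ′ = accepted-tail accʷ
    v<M : value p v < m p (length w)
    v<M = subst (λ l → value p v < m p l) lenᵗ (value<m accᵛ′)
    eq′ : a * m p (length w) + value p v ≡ b * m p (length w) + value p w
    eq′ = subst (λ l → a * m p l + value p v ≡ b * m p (length w) + value p w) lenᵗ eq
    a≡b : a ≡ b
    a≡b = ≤-antisym (leading-digit-≤ (value<m accʷ′) (sym eq′)) (leading-digit-≤ v<M eq′)
    v≡w : v ≡ w
    v≡w = value-injective accᵛ′ accʷ′ lenᵗ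
      (+-cancelˡ-≡ (b * m p (length w)) _ _
        (subst (λ x → x * m p (length w) + value p v ≡ b * m p (length w) + value p w) a≡b eq′))

  -- `m p (length v)` separates the two: `v` stays below it, and the nonzero leading digit of `w`
  -- alone contributes at least that much.
  shorter⇒smaller : ∀ {v w} → Accepted d v → LeadingNonZero w →
    length v < length w → value p v < value p w
  shorter⇒smaller {v} {zero ∷ w}  _   nz _           = ⊥-elim (nz refl)
  shorter⇒smaller {v} {suc b ∷ w} acc _  (s≤s shorter) = begin-strict
    value p v           <⟨ value<m acc ⟩
    m p (length v)      ≤⟨ m-mono shorter ⟩
    m p (length w)      ≤⟨ m≤m+n _ _ ⟩
    suc b * m p (length w)               ≤⟨ m≤m+n _ _ ⟩
    suc b * m p (length w) + value p w   ∎
    where open ≤-Reasoning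

  metallic-accepted : ∀ {n w} → IsMetallicWord p n w → Accepted d w
  metallic-accepted word = accept digits no-forbidden
    where open IsMetallicWord word

  accepted-metallic : ∀ {w} → Accepted d w → LeadingNonZero w → IsMetallicWord p (value p w) w
  accepted-metallic acc nz = record
    { digits          = accepted⇒digits acc
    ; leading-nonzero = nz
    ; represents      = refl
    ; no-forbidden    = accepted⇒no-forbidden acc
    }

  metallic-unique : ∀ {n v w} → IsMetallicWord p n v → IsMetallicWord p n w → v ≡ w
  metallic-unique {n} {v} {w} wordᵛ wordʷ with <-cmp (length v) (length w)
  ... | tri< v<w _ _ = contradiction v≡w (<⇒≢ (shorter⇒smaller accᵛ (leading-nonzero wordʷ) v<w))
    where
    open IsMetallicWord
    accᵛ = metallic-accepted wordᵛ
    v≡w  = trans (sym (represents wordᵛ)) (represents wordʷ)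
  ... | tri≈ _ len _ = value-injective (metallic-accepted wordᵛ) (metallic-accepted wordʷ) len
    (trans (sym (represents wordᵛ)) (represents wordʷ))
    where open IsMetallicWord
  ... | tri> _ _ w<v = contradiction w≡v (<⇒≢ (shorter⇒smaller accʷ (leading-nonzero wordᵛ) w<v))
    where
    open IsMetallicWord
    accʷ = metallic-accepted wordʷ
    w≡v  = trans (sym (represents wordʷ)) (represents wordᵛ)

  metallic-code : ∀ {n w} → IsMetallicWord p n w → MetallicCode p n w
  metallic-code word = word , metallic-unique word

  -- Existence of the metallic code.

  -- Greedy choice: the first digit is the quotient by `m p j` if that is below `e`; otherwise it is
  -- `e`, and what is left is below `bound c j`.
  represent : ∀ e j n → n < bound e j → ∃ λ w → length w ≡ j × Accepted e w × value p w ≡ n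
  represent e zero    n n<1 = [] , refl , [] , sym (n<1⇒n≡0 n<1)
  represent e (suc j) n n<b with n <? e * m p j
  ... | yes n<eM
    with a , r , a<e , r<M , n≡ ← divide (≤-<-trans z≤n (n<m j)) n<eM
    with w , refl , acc , val ← represent d j r (subst (r <_) (sym (bound-d j)) r<M)
    = a ∷ w , refl , below a<e acc , trans (cong (a * m p j +_) val) n≡
  ... | no n≮eM
    with w , refl , acc , val ← represent c j (n ∸ e * m p j)
           (m<n+o⇒m∸n<o n (e * m p j) {{>-nonZero (bound-positive c j)}} n<b)
    = e ∷ w , refl , top acc , trans (cong (e * m p j +_) val) (m+[n∸m]≡n (≮⇒≥ n≮eM))

  -- `represent` pads with leading zeros; a positive value ensures that a nonzero digit remains.
  strip-zeros : ∀ {w} → Accepted d w → 1 ≤ value p w →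
    ∃ λ v → IsMetallicWord p (value p w) v
  strip-zeros {zero ∷ w}  acc 1≤w = strip-zeros (accepted-tail acc) 1≤w
  strip-zeros {suc a ∷ w} acc _   = suc a ∷ w , accepted-metallic acc λ ()

  metallic-word : ∀ {n} → 1 ≤ n → ∃ λ w → IsMetallicWord p n w
  metallic-word {n} 1≤n with represent d n n (subst (n <_) (sym (bound-d n)) (n<m n))
  ... | w , _ , acc , refl = strip-zeros acc 1≤n

  -- Appending a digit.

  value-∷ʳ : ∀ w a → value p (w ∷ʳ a) ≡ value p (w ∷ʳ 0) + a
  value-∷ʳ []      a = trans (+-identityʳ _) (*-identityʳ a)
  value-∷ʳ (b ∷ w) a rewrite length-∷ʳ w a | length-∷ʳ w 0 | value-∷ʳ w a =
    sym (+-assoc (b * m p (suc (length w))) _ a)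

  -- The recurrence of `m` is applied to each digit of `w`, which has three consecutive metallic
  -- numbers as weights in `w`, `w a` and `w a 0`. The last digit `a` uses the instance with
  -- `m₋₁ p 0 = 0`.
  value-shift : ∀ w a → value p (w ∷ʳ a ∷ʳ 0) + value p w ≡ (3 + k) * value p (w ∷ʳ a)
  value-shift [] a = base a k
    where
    base : ∀ a k → a * ((3 + k) * 1) + 0 + 0 ≡ (3 + k) * (a * 1 + 0)
    base = solve-∀
  value-shift (b ∷ w) a
    rewrite length-∷ʳ (w ∷ʳ a) 0 | length-∷ʳ w a = begin
      b * M₂ + V₂ + (b * M₀ + V₀)              ≡⟨ regroup b M₂ V₂ M₀ V₀ ⟩
      b * (M₂ + M₀) + (V₂ + V₀)                ≡⟨ cong₂ (λ x y → b * x + y) (m-recurrence (suc l)) (value-shift w a) ⟩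
      b * ((3 + k) * M₁) + (3 + k) * V₁        ≡⟨ factor b k M₁ V₁ ⟩
      (3 + k) * (b * M₁ + V₁)                  ∎
    where
    open ≡-Reasoning
    l  = length w
    M₀ = m p l
    M₁ = m p (suc l)
    M₂ = m p (suc (suc l))
    V₀ = value p w
    V₁ = value p (w ∷ʳ a)
    V₂ = value p (w ∷ʳ a ∷ʳ 0)
    regroup : ∀ b M₂ V₂ M₀ V₀ → b * M₂ + V₂ + (b * M₀ + V₀) ≡ b * (M₂ + M₀) + (V₂ + V₀)
    regroup = solve-∀
    factor : ∀ b k M V → b * ((3 + k) * M) + (3 + k) * V ≡ (3 + k) * (b * M + V)
    factor = solve-∀

  metallic-shift : ∀ {n w} → IsMetallicWord p n w → IsMetallicWord p (value p (w ∷ʳ 0)) (w ∷ʳ 0)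
  metallic-shift {w = w} word =
    accepted-metallic (accepted-∷ʳ0 z<s (metallic-accepted word)) (nonzero w leading-nonzero)
    where
    open IsMetallicWord word
    nonzero : ∀ w → LeadingNonZero w → LeadingNonZero (w ∷ʳ 0)
    nonzero (a ∷ w) nz = nz

  metallic-init : ∀ {n} w → IsMetallicWord p n (w ∷ʳ 0) → IsMetallicWord p (value p w) w
  metallic-init w word =
    accepted-metallic (accepted-init w (metallic-accepted word)) (nonzero w leading-nonzero)
    where
    open IsMetallicWord word
    nonzero : ∀ w → LeadingNonZero (w ∷ʳ 0) → LeadingNonZero w
    nonzero []      nz = nz refl
    nonzero (a ∷ w) nz = nz

  metallic-positive : ∀ {n w} → IsMetallicWord p n w → 1 ≤ n
  metallic-positive word = subst (1 ≤_) (sym represents)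
    (shorter⇒smaller [] leading-nonzero (nonempty leading-nonzero))
    where
    open IsMetallicWord word
    nonempty : ∀ {w} → LeadingNonZero w → 0 < length w
    nonempty {a ∷ w} _ = z<s

  zeros-∷ʳ : ∀ n → replicate n 0 ∷ʳ 0 ≡ replicate (suc n) 0
  zeros-∷ʳ zero    = refl
  zeros-∷ʳ (suc n) = cong (0 ∷_) (zeros-∷ʳ n)

  value-zeros : ∀ n → value p (replicate n 0) ≡ 0
  value-zeros zero    = refl
  value-zeros (suc n) = value-zeros n

  value-1zeros : ∀ n → value p (1 ∷ replicate n 0) ≡ m p n
  value-1zeros n = trans
    (cong₂ (λ l v → 1 * m p l + v) (length-replicate n) (value-zeros n))
    (trans (+-identityʳ _) (+-identityʳ _))

  metallic-1zeros : ∀ n → IsMetallicWord p (m p n) (1 ∷ replicate n 0)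
  metallic-1zeros n = subst (λ x → IsMetallicWord p x (1 ∷ replicate n 0)) (value-1zeros n)
    (accepted-metallic (below (s≤s (s≤s z≤n)) (zeros n)) λ ())
    where
    zeros : ∀ n → Accepted d (replicate n 0)
    zeros zero    = []
    zeros (suc n) = below z<s (zeros n)

-- The tree: used numbers and their final colours.

module Tree (k : ℕ) (α : ℕ → ℕ) (α-assignment : IsAssignment (5 + k) α) where

  open Numeration k

  F : ℕ → ℕ
  F t = firstUnused (after p α t)

  d≤sonCount : ∀ x → d ≤ sonCount p x
  d≤sonCount black = ≤-refl
  d≤sonCount white = n≤1+n d

  F<F-suc : ∀ t → F t < F (suc t)
  F<F-suc t = m<m+n (F t) (≤-trans (s≤s z≤n) (d≤sonCount (colour p α (suc t))))

  -- Node `suc t` is already used, hence coloured, when its turn comes.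
  2+t≤F : ∀ t → 2 + t ≤ F t
  2+t≤F zero    = ≤-refl
  2+t≤F (suc t) = ≤-trans (s≤s (2+t≤F t)) (F<F-suc t)

  F-mono : ∀ {s t} → s ≤ t → F s ≤ F t
  F-mono = mono ∘ ≤⇒≤′
    where
    mono : ∀ {s t} → s ≤′ t → F s ≤ F t
    mono ≤′-refl       = ≤-refl
    mono (≤′-step {n} s≤n) = ≤-trans (mono s≤n) (<⇒≤ (F<F-suc n))

  colour-kept : ∀ {s t u} → t ≤ u → s < F t →
    colourOf (after p α u) s ≡ colourOf (after p α t) s
  colour-kept {s} {t} t≤u s<Ft = kept (≤⇒≤′ t≤u)
    where
    kept : ∀ {u} → t ≤′ u → colourOf (after p α u) s ≡ colourOf (after p α t) s
    kept ≤′-refl = refl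
    kept (≤′-step {u} t≤u) = trans
      (if-yes (s <? F u) (<-≤-trans s<Ft (F-mono (≤′⇒≤ t≤u))))
      (kept t≤u)

  -- `colour p α s` is read just before `s` is processed, which may precede or follow stage `t`; `s`
  -- is used at both, and later stages keep its colour.
  colour-final : ∀ {s t} → s < F t → colour p α s ≡ colourOf (after p α t) s
  colour-final {s} {t} s<Ft with ≤-total (pred s) t
  ... | inj₁ ≤t = sym (colour-kept ≤t (s<F-pred s))
    where
    s<F-pred : ∀ s → s < F (pred s)
    s<F-pred zero    = s≤s z≤n
    s<F-pred (suc s) = 2+t≤F s
  ... | inj₂ t≤ = colour-kept t≤ s<Ft

  colour-son : ∀ {s} t → F t ≤ s → s < F (suc t) →
    colour p α s ≡ (if does (suc s ≟ F t + α (suc t)) then black else white)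
  colour-son {s} t Ft≤s s<F = trans (colour-final {s} {suc t} s<F)
    (if-no (s <? F t) (≤⇒≯ Ft≤s))

  colour-black-son : ∀ {s} t → F t ≤ s → s < F (suc t) →
    suc s ≡ F t + α (suc t) → colour p α s ≡ black
  colour-black-son t Ft≤s s<F eq = trans (colour-son t Ft≤s s<F)
    (if-yes (_ ≟ _) eq)

  colour-white-son : ∀ {s} t → F t ≤ s → s < F (suc t) →
    suc s ≢ F t + α (suc t) → colour p α s ≡ white
  colour-white-son t Ft≤s s<F neq = trans (colour-son t Ft≤s s<F)
    (if-no (_ ≟ _) neq)

  -- Counting black nodes.

  isBlack : Colour → ℕ
  isBlack black = 1
  isBlack white = 0

  -- The count starts at 0, which is no node; its placeholder colour is white, so it adds nothing.
  blacksBelow : ℕ → ℕ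
  blacksBelow zero    = 0
  blacksBelow (suc n) = isBlack (colour p α n) + blacksBelow n

  blacksBelow-mono : ∀ {i j} → i ≤ j → blacksBelow i ≤ blacksBelow j
  blacksBelow-mono = mono ∘ ≤⇒≤′
    where
    mono : ∀ {i j} → i ≤′ j → blacksBelow i ≤ blacksBelow j
    mono ≤′-refl       = ≤-refl
    mono (≤′-step i≤j) = ≤-trans (mono i≤j) (m≤n+m _ _)

  blacksBelow-white : ∀ {i j} → i ≤ j → (∀ s → i ≤ s → s < j → colour p α s ≡ white) →
    blacksBelow j ≡ blacksBelow i
  blacksBelow-white {i} = run ∘ ≤⇒≤′
    where
    run : ∀ {j} → i ≤′ j → (∀ s → i ≤ s → s < j → colour p α s ≡ white) →
      blacksBelow j ≡ blacksBelow i
    run ≤′-refl           _      = refl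
    run (≤′-step {j} i≤j) whites = cong₂ _+_
      (cong isBlack (whites j (≤′⇒≤ i≤j) ≤-refl))
      (run i≤j (λ s i≤s s<j → whites s i≤s (m<n⇒m<1+n s<j)))

  -- From `F t` up to `F (suc t)` come the sons of `suc t`, exactly one of them black wherever `α`
  -- puts it.
  blacksBelow-F : ∀ t → blacksBelow (F t) ≡ t
  blacksBelow-F zero    = refl
  blacksBelow-F (suc t) = begin
    blacksBelow (F (suc t))                  ≡⟨ blacksBelow-white b<F white-after ⟩
    isBlack (colour p α b) + blacksBelow b   ≡⟨ cong₂ _+_ (cong isBlack (colour-black-son t Ft≤b b<F b-black)) (blacksBelow-white Ft≤b white-before) ⟩
    suc (blacksBelow (F t))                  ≡⟨ cong suc (blacksBelow-F t) ⟩
    suc t                                    ∎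
    where
    open ≡-Reasoning
    -- Positions count from 1, hence the `pred`.
    b = F t + pred (α (suc t))
    1≤α : 1 ≤ α (suc t)
    1≤α = proj₁ (α-assignment (suc t) (s≤s z≤n))
    b-black : suc b ≡ F t + α (suc t)
    b-black = trans (sym (+-suc (F t) _)) (cong (F t +_) (suc-pred (α (suc t)) {{>-nonZero 1≤α}}))
    Ft≤b : F t ≤ b
    Ft≤b = m≤m+n (F t) _
    b<F : b < F (suc t)
    b<F = subst (_≤ F (suc t)) (sym b-black)
      (+-monoʳ-≤ (F t) (proj₂ (α-assignment (suc t) (s≤s z≤n))))
    white-before : ∀ s → F t ≤ s → s < b → colour p α s ≡ white
    white-before s Ft≤s s<b = colour-white-son t Ft≤s (<-trans s<b b<F)
      (λ eq → <⇒≢ (s≤s s<b) (trans eq (sym b-black)))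
    white-after : ∀ s → b < s → s < F (suc t) → colour p α s ≡ white
    white-after s b<s s<F = colour-white-son t (≤-trans Ft≤b (<⇒≤ b<s)) s<F
      (λ eq → <⇒≢ (s≤s b<s) (trans b-black (sym eq)))

  -- A black node has one son fewer, which its own unit in the count makes up for, so each node adds
  -- `p - 2` to the sum.
  F-balance : ∀ t → F t + blacksBelow (suc t) ≡ 2 + (3 + k) * t
  F-balance zero    = cong (2 +_) (sym (*-zeroʳ (3 + k)))
  F-balance (suc t) = begin
    F t + sonCount p x + (isBlack x + B)    ≡⟨ regroup (F t) (sonCount p x) (isBlack x) B ⟩
    F t + B + (sonCount p x + isBlack x)    ≡⟨ cong₂ _+_ (F-balance t) (white-or-black x) ⟩
    2 + (3 + k) * t + (3 + k)               ≡⟨ cong (2 +_) (trans (+-comm _ (3 + k)) (sym (*-suc (3 + k) t))) ⟩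
    2 + (3 + k) * suc t                     ∎
    where
    open ≡-Reasoning
    x = colour p α (suc t)
    B = blacksBelow (suc t)
    regroup : ∀ f s i b → f + s + (i + b) ≡ f + b + (s + i)
    regroup = solve-∀
    white-or-black : ∀ x → sonCount p x + isBlack x ≡ 3 + k
    white-or-black black = +-comm d 1
    white-or-black white = +-identityʳ (3 + k)

  -- Shifted words represent sons.

  mutual
    -- Induction from the last digit. The balance at `x` reduces the claim to
    -- `blacksBelow (suc x) ≤ suc y`, which follows from `x < F (suc y)`.
    shift-upper : ∀ {w} → Reverse w → All (_≤ d) w → value p (w ∷ʳ 0) < F (value p w)
    shift-upper []             _  = s≤s z≤n
    shift-upper (w ∶ rev ∶ʳ a) ds = +-cancelʳ-≤ (suc y) _ _ (begin
      suc z + suc y                      ≡⟨ +-suc (suc z) y ⟩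
      2 + (z + y)                        ≡⟨ cong (2 +_) (value-shift w a) ⟩
      2 + (3 + k) * x                    ≡⟨ F-balance x ⟨
      F x + blacksBelow (suc x)          ≤⟨ +-monoʳ-≤ (F x) (blacksBelow-mono x<F) ⟩
      F x + blacksBelow (F (suc y))      ≡⟨ cong (F x +_) (blacksBelow-F (suc y)) ⟩
      F x + suc y                        ∎)
      where
      open ≤-Reasoning
      x = value p (w ∷ʳ a)
      y = value p w
      z = value p (w ∷ʳ a ∷ʳ 0)
      x<F : x < F (suc y)
      x<F = begin-strict
        x                       ≡⟨ value-∷ʳ w a ⟩
        -- Node `suc y` has at least `d` sons, so adding `a ≤ d` to a number below `F y` does not
        -- reach `F (suc y)`.
        value p (w ∷ʳ 0) + a    <⟨ +-mono-<-≤ (shift-upper rev (proj₁ (∷ʳ⁻ ds))) (≤-trans (proj₂ (∷ʳ⁻ ds)) (d≤sonCount (colour p α (suc y)))) ⟩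
        F (suc y)               ∎

    -- The balance at `t` reduces the claim to `y ≤ suc (blacksBelow (suc t))`; for `y = suc u`,
    -- induction gives `F u ≤ value p (w ∷ʳ 0) ≤ suc t`.
    shift-lower : ∀ {w t} → Reverse w → All (_≤ d) w → value p w ≡ suc t → F t ≤ value p (w ∷ʳ 0)
    shift-lower {_} {t} (w ∶ rev ∶ʳ a) ds x≡1+t = +-cancelʳ-≤ y _ _ (begin
      F t + y                                ≤⟨ +-monoʳ-≤ (F t) (y≤ y refl) ⟩
      F t + suc (blacksBelow (suc t))        ≡⟨ +-suc (F t) _ ⟩
      suc (F t + blacksBelow (suc t))        ≡⟨ cong suc (F-balance t) ⟩
      -- Here `p ≥ 5` enters as `3 ≤ p - 2`.
      3 + (3 + k) * t                        ≤⟨ +-monoˡ-≤ ((3 + k) * t) (m≤m+n 3 k) ⟩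
      3 + k + (3 + k) * t                    ≡⟨ *-suc (3 + k) t ⟨
      (3 + k) * suc t                        ≡⟨ cong ((3 + k) *_) x≡1+t ⟨
      (3 + k) * value p (w ∷ʳ a)             ≡⟨ value-shift w a ⟨
      value p (w ∷ʳ a ∷ʳ 0) + y              ∎)
      where
      open ≤-Reasoning
      y = value p w
      y≤ : ∀ n → y ≡ n → n ≤ suc (blacksBelow (suc t))
      y≤ zero    _     = z≤n
      y≤ (suc u) y≡1+u = s≤s (begin
        u                                   ≡⟨ blacksBelow-F u ⟨
        blacksBelow (F u)                   ≤⟨ blacksBelow-mono (shift-lower rev (proj₁ (∷ʳ⁻ ds)) y≡1+u) ⟩
        blacksBelow (value p (w ∷ʳ 0))      ≤⟨ blacksBelow-mono (m≤m+n (value p (w ∷ʳ 0)) a) ⟩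
        blacksBelow (value p (w ∷ʳ 0) + a)  ≡⟨ cong blacksBelow (trans (sym (value-∷ʳ w a)) x≡1+t) ⟩
        blacksBelow (suc t)                 ∎)

  -- Existence and uniqueness of preferred sons.

  shift-son : ∀ {n w} → IsMetallicWord p n w → IsSon p α n (value p (w ∷ʳ 0))
  shift-son {zero}      word = contradiction (metallic-positive word) λ ()
  shift-son {suc t} {w} word =
    shift-lower (reverseView w) digits (sym represents) ,
    subst (λ x → value p (w ∷ʳ 0) < F x) (sym represents) (shift-upper (reverseView w) digits)
    where open IsMetallicWord word

  shift-preferred : ∀ {n w} → IsMetallicWord p n w → IsPreferredSon p α n (value p (w ∷ʳ 0))
  shift-preferred {w = w} word = shift-son word , w , metallic-code (metallic-shift word)

  father-≥ : ∀ {μ ν s} → 1 ≤ ν → IsSon p α μ s → IsSon p α ν s → ν ≤ μ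
  father-≥ {μ} {suc t} _ (_ , s<Fμ) (Ft≤s , _) =
    ≰⇒> λ μ≤t → <-irrefl refl (<-≤-trans s<Fμ (≤-trans (F-mono μ≤t) Ft≤s))

  father-unique : ∀ {μ ν s} → 1 ≤ μ → 1 ≤ ν → IsSon p α μ s → IsSon p α ν s → μ ≡ ν
  father-unique 1≤μ 1≤ν sonμ sonν = ≤-antisym (father-≥ 1≤μ sonν sonμ) (father-≥ 1≤ν sonμ sonν)

  -- If `s` has code `v 0`, then `s` is also a son of `value p v`. As fathers are unique, `v`
  -- represents `ν`, and uniqueness of codes gives `v ≡ w`.
  preferred-code : ∀ {ν s w} → IsMetallicWord p ν w → IsPreferredSon p α ν s →
    IsMetallicWord p s (w ∷ʳ 0)
  preferred-code {ν} {s} {w} word (son , v , wordˢ , _) =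
    subst (λ u → IsMetallicWord p s (u ∷ʳ 0)) v≡w wordˢ
    where
    wordᵛ : IsMetallicWord p (value p v) v
    wordᵛ = metallic-init v wordˢ
    v≡ν : value p v ≡ ν
    v≡ν = father-unique (metallic-positive wordᵛ) (metallic-positive word)
      (subst (IsSon p α (value p v)) (sym (IsMetallicWord.represents wordˢ)) (shift-son wordᵛ)) son
    v≡w : v ≡ w
    v≡w = metallic-unique (subst (λ n → IsMetallicWord p n v) v≡ν wordᵛ) word

  preferred-son-property : PreferredSonProperty p α
  preferred-son-property ν 1≤ν with w , word ← metallic-word 1≤ν =
    (value p (w ∷ʳ 0) , shift-preferred word ,
      λ pref → sym (IsMetallicWord.represents (preferred-code word pref))) ,
    λ s pref → w , metallic-code word , metallic-code (preferred-code word pref)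

  -- The code of `m p n` is 1 followed by `n` zeros, so appending 0 gives the code of the next
  -- metallic number.
  m-preferred : ∀ n → IsPreferredSon p α (m p n) (m p (suc n))
  m-preferred n = subst (IsPreferredSon p α (m p n))
    (trans (cong (λ w → value p (1 ∷ w)) (zeros-∷ʳ n)) (value-1zeros (suc n)))
    (shift-preferred (metallic-1zeros n))

theorem7 : ∀ (p : ℕ) → 5 ≤ p → (α : ℕ → ℕ) → IsAssignment p α →
    PreferredSonProperty p α
    × (∀ n → IsPreferredSon p α (m p n) (m p (suc n)))
theorem7 _ (s≤s (s≤s (s≤s (s≤s (s≤s (z≤n {k})))))) α asg =
  preferred-son-property , m-preferred
  where open Tree k α asg
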